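{- Let $(X,d)$ be a dissimilarity space. For any $p\in X$, the family $\mathcal{C}_p$ consisting of $\{p\}$ together with all copoints at $p$ is a partition of $X$.
   Context: Let $X$ be a finite set. A dissimilarity on $X$ is a symmetric function $d:X\times X\to[0,\infty)$ with $d(x,x)=0$ for all $x$; $(X,d)$ is then a dissimilarity space. A set $M\subseteq X$ is an mmodule of $(X,d)$ if for every $z\in X\setminus M$ and all $x,y\in M$ one has $d(z,x)=d(z,y)$. For $p\in X$, a copoint at $p$ is an inclusion-maximal mmodule among the mmodules not containing $p$. A partition of $X$ is a family of pairwise disjoint subsets of $X$ with union $X$. -}

module Defs where

open import Data.Fin.Base using (Fin)
open import Data.Fin.Subset using (Subset; _∈_; _∉_; _⊆_; _∩_; Empty; ⁅_⁆)
open import Data.Nat.Base using (ℕ)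
open import Data.Product using (∃; ∃-syntax; _×_; _,_)
open import Data.Rational.Base using (ℚ; 0ℚ; 1ℚ; _<_; _+_; _-_; -_)
open import Data.Rational.Properties
  using (<-dense; <-trans; <-asym; <-cmp; +-monoʳ-<; +-identityʳ; positive⁻¹; negative⁻¹)
open import Data.Sum.Base using (_⊎_; inj₁; inj₂)
open import Function.Bundles using (_⇔_; mk⇔)
open import Level using (0ℓ)
open import Relation.Binary.Definitions using (tri<; tri≈; tri>)
open import Relation.Binary.PropositionalEquality using (_≡_; _≢_; refl; subst)
open import Relation.Nullary using (¬_)
import Relation.Unary as U

-- Two-sided Dedekind cuts of ℚ.
record ℝ : Set₁ where
  field
    lower           : U.Pred ℚ 0ℓ
    upper           : U.Pred ℚ 0ℓ
    lower-inhabited : ∃ lower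
    upper-inhabited : ∃ upper
    lower-rounded   : ∀ q → lower q ⇔ (∃[ r ] q < r × lower r)
    upper-rounded   : ∀ q → upper q ⇔ (∃[ r ] r < q × upper r)
    disjoint        : ∀ q → ¬ (lower q × upper q)
    located         : ∀ {q r} → q < r → lower q ⊎ upper r

open ℝ

infix 4 _≤ℝ_ _≈ℝ_

-- The lower cut of a real determines its upper cut, so comparing lower cuts
-- suffices.
_≤ℝ_ : ℝ → ℝ → Set
x ≤ℝ y = lower x U.⊆ lower y

_≈ℝ_ : ℝ → ℝ → Set
x ≈ℝ y = x ≤ℝ y × y ≤ℝ x

fromℚ : ℚ → ℝ
fromℚ a = record
  { lower           = _< a
  ; upper           = a <_
  ; lower-inhabited = a - 1ℚ , subst (a - 1ℚ <_) (+-identityʳ a) (+-monoʳ-< a (negative⁻¹ (- 1ℚ)))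
  ; upper-inhabited = a + 1ℚ , subst (_< a + 1ℚ) (+-identityʳ a) (+-monoʳ-< a (positive⁻¹ 1ℚ))
  ; lower-rounded   = λ _ → mk⇔ <-dense (λ (_ , q<r , r<a) → <-trans q<r r<a)
  ; upper-rounded   = λ _ → mk⇔ (λ a<q → let r , a<r , r<q = <-dense a<q in r , r<q , a<r)
                                (λ (_ , r<q , a<r) → <-trans a<r r<q)
  ; disjoint        = λ _ (q<a , a<q) → <-asym q<a a<q
  ; located         = loc
  }
  where
  loc : ∀ {q r} → q < r → q < a ⊎ a < r
  loc {q} q<r with <-cmp q a
  ... | tri< q<a _ _    = inj₁ q<a
  ... | tri≈ _ refl _   = inj₂ q<r
  ... | tri> _ _ a<q    = inj₂ (<-trans a<q q<r)

0ℝ : ℝ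
0ℝ = fromℚ 0ℚ

-- The underlying n-element set is Fin n.
record DissimilaritySpace (n : ℕ) : Set₁ where
  field
    d        : Fin n → Fin n → ℝ
    d-nonneg : ∀ x y → 0ℝ ≤ℝ d x y
    d-sym    : ∀ x y → d x y ≈ℝ d y x
    d-diag   : ∀ x → d x x ≈ℝ 0ℝ

module _ {n : ℕ} (D : DissimilaritySpace n) where
  open DissimilaritySpace D

  IsMModule : Subset n → Set
  IsMModule M = ∀ z → z ∉ M → ∀ x y → x ∈ M → y ∈ M → d z x ≈ℝ d z y

  record IsCopoint (p : Fin n) (M : Subset n) : Set where
    field
      isMModule : IsMModule M
      avoids    : p ∉ M
      maximal   : ∀ N → IsMModule N → p ∉ N → M ⊆ N → N ≡ M

  𝒞 : Fin n → U.Pred (Subset n) 0ℓ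
  𝒞 p M = M ≡ ⁅ p ⁆ ⊎ IsCopoint p M

-- Empty blocks are allowed: if X = {p}, the only copoint at p is the empty set.
record IsPartition {n : ℕ} (F : U.Pred (Subset n) 0ℓ) : Set where
  field
    pairwiseDisjoint : ∀ A B → F A → F B → A ≢ B → Empty (A ∩ B)
    covers           : ∀ x → ∃[ A ] F A × x ∈ A

{-# OPTIONS --safe #-}
-- Two overlapping mmodules have an mmodule as union, so two copoints that meet
-- both equal their union. A point x ≢ p lies in the mmodule ⁅ x ⁆, which
-- extends to a maximal one avoiding p because X is finite.
module Submission where

open import Defs
open import Axiom.ExcludedMiddle using (ExcludedMiddle)
open import Data.Empty using (⊥-elim)
open import Data.Fin.Base using (Fin)
open import Data.Fin.Properties using (_≟_)
open import Data.Fin.Subset using (Subset; _∈_; _∉_; _⊆_; _⊃_; _∩_; _∪_; Empty; ⁅_⁆)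
open import Data.Fin.Subset.Induction using (⊃-wellFounded)
open import Data.Fin.Subset.Properties
  using (_∈?_; ⊆-antisym; x∈p∩q⁻; x∈p∪q⁻; p⊆p∪q; q⊆p∪q; x∈⁅x⁆; x∈⁅y⁆⇒x≡y)
open import Data.Nat.Base using (ℕ)
open import Data.Product using (∃-syntax; _×_; _,_)
open import Data.Sum.Base using (inj₁; inj₂; [_,_]′)
open import Function.Base using (_∘_; id)
open import Induction.WellFounded using (Acc; acc)
open import Level using (0ℓ)
open import Relation.Binary.PropositionalEquality using (_≡_; _≢_; refl; sym; trans; subst)
open import Relation.Nullary using (yes; no)

≈ℝ-refl : ∀ {x} → x ≈ℝ x
≈ℝ-refl = id , id

≈ℝ-sym : ∀ {x y} → x ≈ℝ y → y ≈ℝ x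
≈ℝ-sym (x≤y , y≤x) = y≤x , x≤y

≈ℝ-trans : ∀ {x y z} → x ≈ℝ y → y ≈ℝ z → x ≈ℝ z
≈ℝ-trans (x≤y , y≤x) (y≤z , z≤y) = (λ l → y≤z (x≤y l)) , (λ l → y≤x (z≤y l))

module _ {n : ℕ} (D : DissimilaritySpace n) where
  open DissimilaritySpace D

  singleton-isMModule : ∀ x → IsMModule D ⁅ x ⁆
  singleton-isMModule x z _ u v u∈ v∈
    rewrite x∈⁅y⁆⇒x≡y x u∈ | x∈⁅y⁆⇒x≡y x v∈ = ≈ℝ-refl {d z x}

  -- The shared point `w` links the two sets: a `z` outside the union lies outside both, so every
  -- point of either set is as far from `z` as `w` is.
  ∪-isMModule : ∀ {M N w} → IsMModule D M → IsMModule D N → w ∈ M → w ∈ N → IsMModule D (M ∪ N)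
  ∪-isMModule {M} {N} {w} mM mN w∈M w∈N z z∉ x y x∈ y∈ =
    ≈ℝ-trans {d z x} {d z w} {d z y} (to-w x x∈) (≈ℝ-sym {d z y} {d z w} (to-w y y∈))
    where
    to-w : ∀ u → u ∈ M ∪ N → d z u ≈ℝ d z w
    to-w u u∈ with x∈p∪q⁻ M N u∈
    ... | inj₁ u∈M = mM z (z∉ ∘ p⊆p∪q N) u w u∈M w∈M
    ... | inj₂ u∈N = mN z (z∉ ∘ q⊆p∪q M N) u w u∈N w∈N

  meeting-copoints-equal : ∀ {p w A B} → IsCopoint D p A → IsCopoint D p B → w ∈ A → w ∈ B → A ≡ B
  meeting-copoints-equal {p} {w} {A} {B} cA cB w∈A w∈B =
    -- Maximality of `A` gives `A ∪ B ≡ A`, and that of `B` gives `A ∪ B ≡ B`.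
    trans (sym (A.maximal (A ∪ B) mA∪B p∉A∪B (p⊆p∪q B))) (B.maximal (A ∪ B) mA∪B p∉A∪B (q⊆p∪q A B))
    where
    module A = IsCopoint cA
    module B = IsCopoint cB
    mA∪B : IsMModule D (A ∪ B)
    mA∪B = ∪-isMModule A.isMModule B.isMModule w∈A w∈B
    p∉A∪B : p ∉ A ∪ B
    p∉A∪B = [ A.avoids , B.avoids ]′ ∘ x∈p∪q⁻ A B

  -- Climb through strictly larger mmodules avoiding `p` until none exists; the climb stops because
  -- `⊃` is well-founded on subsets of a finite set. Excluded middle tells whether a larger one
  -- exists, since equality of distances given as Dedekind cuts is not decidable in general.
  extend-to-copoint : ExcludedMiddle 0ℓ → ∀ {p M} → IsMModule D M → p ∉ M →
                      ∃[ C ] IsCopoint D p C × M ⊆ C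
  extend-to-copoint em {p} {M} = go M (⊃-wellFounded M)
    where
    go : ∀ M → Acc _⊃_ M → IsMModule D M → p ∉ M → ∃[ C ] IsCopoint D p C × M ⊆ C
    go M (acc rec) mM p∉M with em {∃[ N ] IsMModule D N × p ∉ N × N ⊃ M}
    ... | yes (N , mN , p∉N , N⊃M@(M⊆N , _)) =
      let C , cC , N⊆C = go N (rec N⊃M) mN p∉N in C , cC , N⊆C ∘ M⊆N
    ... | no ¬larger = M , record { isMModule = mM ; avoids = p∉M ; maximal = maximal } , id
      where
      maximal : ∀ N → IsMModule D N → p ∉ N → M ⊆ N → N ≡ M
      maximal N mN p∉N M⊆N = ⊆-antisym N⊆M M⊆N
        where
        N⊆M : N ⊆ M
        N⊆M {x} x∈N with x ∈? M
        ... | yes x∈M = x∈M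
        -- Such an `x` would make `N` a strictly larger mmodule avoiding `p`.
        ... | no x∉M = ⊥-elim (¬larger (N , mN , p∉N , M⊆N , x , x∈N , x∉M))

  -- The only point of `⁅ p ⁆` is `p`, which a copoint avoids by definition. This settles the mixed
  -- cases of pairwise disjointness.
  copoint-disjoint-⁅p⁆ : ∀ {p w A} → IsCopoint D p A → w ∈ A → w ∉ ⁅ p ⁆
  copoint-disjoint-⁅p⁆ {p} {A = A} cA w∈A w∈p =
    IsCopoint.avoids cA (subst (_∈ A) (x∈⁅y⁆⇒x≡y p w∈p) w∈A)

lemma3p6 : ExcludedMiddle 0ℓ → ∀ (n : ℕ) (D : DissimilaritySpace n) (p : Fin n) → IsPartition (𝒞 D p)
lemma3p6 em n D p = record { pairwiseDisjoint = pairwiseDisjoint ; covers = covers }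
  where
  pairwiseDisjoint : ∀ A B → 𝒞 D p A → 𝒞 D p B → A ≢ B → Empty (A ∩ B)
  pairwiseDisjoint A B FA FB A≢B (w , w∈) with x∈p∩q⁻ A B w∈
  pairwiseDisjoint A B (inj₁ refl) (inj₁ refl) A≢B _ | _ = A≢B refl
  pairwiseDisjoint A B (inj₁ refl) (inj₂ cB) _ _ | w∈A , w∈B = copoint-disjoint-⁅p⁆ D cB w∈B w∈A
  pairwiseDisjoint A B (inj₂ cA) (inj₁ refl) _ _ | w∈A , w∈B = copoint-disjoint-⁅p⁆ D cA w∈A w∈B
  pairwiseDisjoint A B (inj₂ cA) (inj₂ cB) A≢B _ | w∈A , w∈B =
    A≢B (meeting-copoints-equal D cA cB w∈A w∈B)

  covers : ∀ x → ∃[ A ] 𝒞 D p A × x ∈ A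
  covers x with p ≟ x
  ... | yes refl = ⁅ p ⁆ , inj₁ refl , x∈⁅x⁆ p
  ... | no p≢x =
    -- Membership of `p` in `⁅ x ⁆` would force `p ≡ x`, so `⁅ x ⁆` avoids `p` and can be extended
    -- to the block through `x`.
    let C , cC , x⊆C = extend-to-copoint D em (singleton-isMModule D x) (p≢x ∘ x∈⁅y⁆⇒x≡y x)
    in C , inj₂ cC , x⊆C (x∈⁅x⁆ x)
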